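{- For every integer $k\ge1$, $N(2k+5,k)=1$.
   Context: For $n>k\ge1$, $N(n,k)$ is the nullity of the $n\times n$ skew-symmetric Toeplitz matrix $A(n,k)$ whose first $k$ superdiagonals have all entries $1$ and whose remaining superdiagonals have all entries $0$. -}

module Defs where

open import Algebra.Bundles using (CommutativeRing)
open import Data.Bool.Base using (if_then_else_)
open import Data.Fin.Base using (Fin; toℕ)
open import Data.Nat.Base as ℕ using (ℕ; _∸_)
open import Data.Nat.Properties using (_≤?_; <-cmp)
open import Data.Product.Base using (_×_; ∃-syntax)
open import Data.Rational.Base using (ℚ; 0ℚ; 1ℚ; -_; _*_)
open import Data.Rational.Properties using (+-*-commutativeRing)
open import Data.Vec.Functional using (Vector)
open import Relation.Binary.Definitions using (tri<; tri≈; tri>)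
open import Relation.Binary.PropositionalEquality.Core using (_≡_; _≗_)
open import Relation.Nullary.Decidable.Core using (does)

open import Algebra.Properties.Monoid.Sum (CommutativeRing.+-monoid +-*-commutativeRing) public
  using (sum; sum-syntax)

Matrix : ℕ → ℕ → Set
Matrix m n = Fin m → Fin n → ℚ

_·_ : ∀ {m n} → Matrix m n → Vector ℚ n → Vector ℚ m
_·_ {n = n} M v i = ∑[ j < n ] (M i j * v j)

Kernel : ∀ {m n} → Matrix m n → Vector ℚ n → Set
Kernel M v = ∀ i → (M · v) i ≡ 0ℚ

linComb : ∀ {n d} → Vector ℚ d → (Fin d → Vector ℚ n) → Vector ℚ n
linComb {d = d} c b j = ∑[ l < d ] (c l * b l j)

LinearlyIndependent : ∀ {n d} → (Fin d → Vector ℚ n) → Set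
LinearlyIndependent {d = d} b =
  (c : Vector ℚ d) → (∀ j → linComb c b j ≡ 0ℚ) → ∀ l → c l ≡ 0ℚ

IsBasisOf : ∀ {n d} → (Vector ℚ n → Set) → (Fin d → Vector ℚ n) → Set
IsBasisOf P b =
  (∀ l → P (b l)) ×
  LinearlyIndependent b ×
  (∀ v → P v → ∃[ c ] linComb c b ≗ v)

-- Dimension as a relation between a subspace and a natural number.
HasDimension : ∀ {n} → (Vector ℚ n → Set) → ℕ → Set
HasDimension {n} P d = ∃[ b ] IsBasisOf {n} {d} P b

HasNullity : ∀ {m n} → Matrix m n → ℕ → Set
HasNullity M d = HasDimension (Kernel M) d

-- The skew-symmetric Toeplitz matrix whose d-th superdiagonal (d ≥ 1, the
-- positions with j - i = d) is constantly a d; the value a 0 is not used.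
skewToeplitz : (n : ℕ) → (ℕ → ℚ) → Matrix n n
skewToeplitz n a i j with <-cmp (toℕ i) (toℕ j)
... | tri< _ _ _ = a (toℕ j ∸ toℕ i)
... | tri≈ _ _ _ = 0ℚ
... | tri> _ _ _ = - a (toℕ i ∸ toℕ j)

A : (n k : ℕ) → Matrix n n
A n k = skewToeplitz n (λ d → if does (d ≤? k) then 1ℚ else 0ℚ)

-- N[ n , k ]≡ d expresses N(n,k) = d; it is meant for n > k ≥ 1.
N[_,_]≡_ : ℕ → ℕ → ℕ → Set
N[ n , k ]≡ d = HasNullity (A n k) d

{-# OPTIONS --safe #-}

-- Extend v by zero and let s m be the sum of the entries of v of index < m.  Row i of A(n,k) v = 0
-- then reads s(i+k+1) + s(i-k) = s(i) + s(i+1), with s = 0 on the left and s constant from n on.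
-- For n = 2k+5 and k ≥ 3 the rows i ≤ k express s on [k+1, 2k+1] by s on [0, k+1], and rows k+1,
-- k+2, k+3 give the next three values.  The remaining rows say, with α = s 1 and γ = s 3, that
-- s 2 = s 4 = 0, that three consecutive values of s on [3, k+1] sum to s n = α + γ, and that
-- s k = γ and s (k+1) = α.  Hence s runs through γ, 0, α periodically from index 3, and the last
-- two conditions cut out a line in the (α, γ)-plane that depends on k modulo 3.
-- For k = 1, 2 these blocks overlap and the system is solved directly.
module Submission where

open import Defs
open import Data.Nat.Base using (ℕ; _+_; _*_; _≥_)

open import Algebra.Bundles using (CommutativeRing)
open import Data.Bool.Base using (if_then_else_)
open import Data.Fin.Base using (Fin; zero; suc; toℕ; fromℕ<)
open import Data.Fin.Properties using (toℕ-fromℕ<; toℕ<n)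
open import Data.Nat.Base using (zero; suc; _∸_; _≤_; _<_; _<ᵇ_; z≤n; s≤s; s≤s⁻¹)
import Data.Nat.Properties as ℕ
open import Data.Nat.Tactic.RingSolver using (solve-∀)
open import Data.Product.Base using (_×_; _,_; ∃-syntax)
open import Data.Rational.Base as ℚ using (ℚ; 0ℚ; 1ℚ)
import Data.Rational.Properties as ℚ
open import Data.Rational.Solver using (module +-*-Solver)
open import Data.Sum.Base using (_⊎_; inj₁; inj₂)
open import Data.Vec.Functional using (Vector; tail)
open import Function.Base using (_∘_; case_of_)
open import Relation.Binary.Definitions using (tri<; tri≈; tri>)
open import Relation.Binary.PropositionalEquality
open import Relation.Nullary.Decidable.Core using (yes; no; does)
open import Relation.Nullary.Decidable using (dec-true; dec-false)

open import Algebra.Properties.CommutativeMonoid.Sum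
  (CommutativeRing.+-commutativeMonoid ℚ.+-*-commutativeRing)
  using (∑-distrib-+; sum-cong-≗)

open import Algebra.Properties.AbelianGroup (CommutativeRing.+-abelianGroup ℚ.+-*-commutativeRing)
  using () renaming (∙-cancelʳ to +-cancelʳ)

open +-*-Solver using (solve; con; _:+_; _:*_; _:-_; _:=_)

private
  variable
    n : ℕ

-- Linear arithmetic over ℚ

-- Hypotheses are added up into a single equation `l ≡ r`; what remains is an identity for the ring
-- solver.
cancelling : ∀ {l r x y} → l ≡ r → x ℚ.+ r ≡ y ℚ.+ l → x ≡ y
cancelling {l} {x = x} {y} refl = +-cancelʳ l x y

-- Solves a `high` row for its leading term when the other terms are known multiples of `c`; the
-- last premise is the same row for the coefficients.
step : ∀ c {x y z w b p q r} → x ℚ.+ y ≡ z ℚ.+ w →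
       y ≡ c ℚ.* b → z ≡ c ℚ.* p → w ≡ c ℚ.* q → r ℚ.+ b ≡ p ℚ.+ q → x ≡ c ℚ.* r
step c {x} {b = b} {p} {q} {r} e refl refl refl e′ =
  cancelling (cong₂ ℚ._+_ e (sym (cong (c ℚ.*_) e′)))
    (solve 6 (λ c x b p q r →
        x :+ ((c :* p :+ c :* q) :+ c :* (r :+ b)) :=
        c :* r :+ ((x :+ c :* b) :+ c :* (p :+ q))) refl c x b p q r)

low-step : ∀ c {x z w p q} → x ≡ z ℚ.+ w → z ≡ c ℚ.* p → w ≡ c ℚ.* q → x ≡ c ℚ.* (p ℚ.+ q)
low-step c {p = p} {q} e refl refl = trans e (sym (ℚ.*-distribˡ-+ c p q))

-- Prefix sums and differences

-- Total in `m`: past `n` it stays at the full sum, which encodes the extension of `v` by zero.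
prefix : Vector ℚ n → ℕ → ℚ
prefix {zero}  v m       = 0ℚ
prefix {suc n} v zero    = 0ℚ
prefix {suc n} v (suc m) = v zero ℚ.+ prefix (tail v) m

prefix-zero : (v : Vector ℚ n) → prefix v 0 ≡ 0ℚ
prefix-zero {zero}  v = refl
prefix-zero {suc n} v = refl

prefix-suc : (v : Vector ℚ n) (i : Fin n) → prefix v (suc (toℕ i)) ≡ prefix v (toℕ i) ℚ.+ v i
prefix-suc v zero    = trans (cong (v zero ℚ.+_) (prefix-zero (tail v))) (ℚ.+-comm (v zero) 0ℚ)
prefix-suc v (suc i) = trans (cong (v zero ℚ.+_) (prefix-suc (tail v) i)) (sym (ℚ.+-assoc (v zero) _ _))

prefix-saturates : (v : Vector ℚ n) → ∀ m → prefix v (n + m) ≡ prefix v n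
prefix-saturates {zero}  v m = refl
prefix-saturates {suc n} v m = cong (v zero ℚ.+_) (prefix-saturates (tail v) m)

prefix-scale : ∀ c (v : Vector ℚ n) m → prefix (λ j → c ℚ.* v j) m ≡ c ℚ.* prefix v m
prefix-scale {zero}  c v m       = sym (ℚ.*-zeroʳ c)
prefix-scale {suc n} c v zero    = sym (ℚ.*-zeroʳ c)
prefix-scale {suc n} c v (suc m) =
  trans (cong (c ℚ.* v zero ℚ.+_) (prefix-scale c (tail v) m)) (sym (ℚ.*-distribˡ-+ c _ _))

prefix-vanishes : (v : Vector ℚ n) → (∀ j → v j ≡ 0ℚ) → ∀ m → prefix v m ≡ 0ℚ
prefix-vanishes {zero}  v z m       = refl
prefix-vanishes {suc n} v z zero    = refl
prefix-vanishes {suc n} v z (suc m) = cong₂ ℚ._+_ (z zero) (prefix-vanishes (tail v) (z ∘ suc) m)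

difference : (ℕ → ℚ) → Vector ℚ n
difference s i = s (suc (toℕ i)) ℚ.- s (toℕ i)

-- Telescoping. The induction passes to `s ∘ suc`, so the initial value cannot be assumed to be 0
-- here.
prefix-difference : ∀ n s {m} → m ≤ n → prefix {n} (difference s) m ≡ s m ℚ.- s 0
prefix-difference n       s {zero}  _         = trans (prefix-zero {n} _) (sym (ℚ.+-inverseʳ (s 0)))
prefix-difference (suc n) s {suc m} (s≤s m≤n) =
  trans (cong (s 1 ℚ.- s 0 ℚ.+_) (prefix-difference n (s ∘ suc) m≤n))
        (solve 3 (λ x y z → (y :- x) :+ (z :- y) := z :- x) refl (s 0) (s 1) (s (suc m)))

-- Rows of the matrix in terms of initial segments

-- With `_<ᵇ_` a common `suc` in both arguments cancels by computation, as the induction in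
-- `sum-below` requires.
below : ℕ → ℕ → ℚ
below m j = if j <ᵇ m then 1ℚ else 0ℚ

below-< : ∀ {m j} → j < m → below m j ≡ 1ℚ
below-< {suc m} {zero}  _         = refl
below-< {suc m} {suc j} (s≤s j<m) = below-< j<m

below-≥ : ∀ {m j} → m ≤ j → below m j ≡ 0ℚ
below-≥ {zero}          _         = refl
below-≥ {suc m} {suc j} (s≤s m≤j) = below-≥ m≤j

sum-below : ∀ (v : Vector ℚ n) m → ∑[ j < n ] (below m (toℕ j) ℚ.* v j) ≡ prefix v m
sum-below {zero}  v m       = refl
sum-below {suc n} v zero    = cong₂ ℚ._+_ (ℚ.*-zeroˡ (v zero)) (trans (sum-below (tail v) 0) (prefix-zero (tail v)))
sum-below {suc n} v (suc m) = cong₂ ℚ._+_ (ℚ.*-identityˡ (v zero)) (sum-below (tail v) m)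

sum-below₂ : ∀ (v : Vector ℚ n) l m →
  ∑[ j < n ] ((below l (toℕ j) ℚ.+ below m (toℕ j)) ℚ.* v j) ≡ prefix v l ℚ.+ prefix v m
sum-below₂ {n} v l m = begin
  ∑[ j < n ] ((below l (toℕ j) ℚ.+ below m (toℕ j)) ℚ.* v j)
    ≡⟨ sum-cong-≗ (λ j → ℚ.*-distribʳ-+ (v j) (below l (toℕ j)) (below m (toℕ j))) ⟩
  ∑[ j < n ] (below l (toℕ j) ℚ.* v j ℚ.+ below m (toℕ j) ℚ.* v j)
    ≡⟨ ∑-distrib-+ (λ j → below l (toℕ j) ℚ.* v j) (λ j → below m (toℕ j) ℚ.* v j) ⟩
  ∑[ j < n ] (below l (toℕ j) ℚ.* v j) ℚ.+ ∑[ j < n ] (below m (toℕ j) ℚ.* v j)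
    ≡⟨ cong₂ ℚ._+_ (sum-below v l) (sum-below v m) ⟩
  prefix v l ℚ.+ prefix v m ∎
  where open ≡-Reasoning


-- Has the shape used in `A`, so that off-diagonal entries are `band` or its negative by
-- computation.
band : ℕ → ℕ → ℚ
band k d = if does (d ℕ.≤? k) then 1ℚ else 0ℚ

band-≤ : ∀ {k d} → d ≤ k → band k d ≡ 1ℚ
band-≤ {k} {d} d≤k = cong (if_then 1ℚ else 0ℚ) (dec-true (d ℕ.≤? k) d≤k)

band-> : ∀ {k d} → k < d → band k d ≡ 0ℚ
band-> {k} {d} k<d = cong (if_then 1ℚ else 0ℚ) (dec-false (d ℕ.≤? k) (ℕ.<⇒≱ k<d))

-- Right of the diagonal all indicators but `below (suc (i + k))` vanish, and `j ∸ i ≤ k` amounts to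
-- `j < suc (i + k)`.
upper-below : ∀ k {i j} → i < j →
  band k (j ∸ i) ℚ.+ (below i j ℚ.+ below (suc i) j) ≡ below (suc (i + k)) j ℚ.+ below (i ∸ k) j
upper-below k {i} {j} i<j = case (j ∸ i) ℕ.≤? k of λ where
    (yes d≤k) → evaluate (band-≤ d≤k)
      (below-< (s≤s (ℕ.≤-trans (ℕ.m≤n+m∸n j i) (ℕ.+-monoʳ-≤ i d≤k))))
    (no d≰k)  → evaluate (band-> (ℕ.≰⇒> d≰k))
      (below-≥ (subst (λ m → suc m ≤ j) (ℕ.+-comm k i) (ℕ.m≤o∸n⇒m+n≤o (suc k) i≤j (ℕ.≰⇒> d≰k))))
  where
  i≤j = ℕ.<⇒≤ i<j
  evaluate : ∀ {x} → band k (j ∸ i) ≡ x → below (suc (i + k)) j ≡ x →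
    band k (j ∸ i) ℚ.+ (below i j ℚ.+ below (suc i) j) ≡ below (suc (i + k)) j ℚ.+ below (i ∸ k) j
  evaluate p q = cong₂ ℚ._+_ (trans p (sym q))
    (trans (cong₂ ℚ._+_ (below-≥ i≤j) (below-≥ i<j)) (sym (below-≥ (ℕ.≤-trans (ℕ.m∸n≤m i k) i≤j))))

diagonal-below : ∀ k {i j} → i ≡ j →
  0ℚ ℚ.+ (below i j ℚ.+ below (suc i) j) ≡ below (suc (i + k)) j ℚ.+ below (i ∸ k) j
diagonal-below k {i} refl =
  trans (cong (0ℚ ℚ.+_) (cong₂ ℚ._+_ (below-≥ (ℕ.≤-refl {i})) (below-< (ℕ.n<1+n i))))
        (sym (cong₂ ℚ._+_ (below-< (s≤s (ℕ.m≤m+n i k))) (below-≥ (ℕ.m∸n≤m i k))))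

-- Left of the diagonal every indicator but `below (i ∸ k)` is 1, so the claim is that the entry is
-- minus the indicator of `i ∸ k ≤ j`.
lower-below : ∀ k {i j} → j < i →
  ℚ.- band k (i ∸ j) ℚ.+ (below i j ℚ.+ below (suc i) j) ≡ below (suc (i + k)) j ℚ.+ below (i ∸ k) j
lower-below k {i} {j} j<i = case (i ∸ j) ℕ.≤? k of λ where
    (yes d≤k) → evaluate (band-≤ d≤k)
      (below-≥ (ℕ.m≤n+o⇒m∸n≤o i k (subst (i ≤_) (ℕ.+-comm j k)
        (ℕ.≤-trans (ℕ.m≤n+m∸n i j) (ℕ.+-monoʳ-≤ j d≤k)))))
      refl
    (no d≰k)  → evaluate (band-> (ℕ.≰⇒> d≰k))
      (below-< (ℕ.m+n≤o⇒m≤o∸n (suc j) (subst (λ m → suc m ≤ i) (ℕ.+-comm k j)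
        (ℕ.m≤o∸n⇒m+n≤o (suc k) (ℕ.<⇒≤ j<i) (ℕ.≰⇒> d≰k)))))
      refl
  where
  evaluate : ∀ {x y} → band k (i ∸ j) ≡ x → below (i ∸ k) j ≡ y → ℚ.- x ℚ.+ (1ℚ ℚ.+ 1ℚ) ≡ 1ℚ ℚ.+ y →
    ℚ.- band k (i ∸ j) ℚ.+ (below i j ℚ.+ below (suc i) j) ≡ below (suc (i + k)) j ℚ.+ below (i ∸ k) j
  evaluate p q e =
    trans (cong₂ ℚ._+_ (cong ℚ.-_ p) (cong₂ ℚ._+_ (below-< j<i) (below-< (ℕ.m<n⇒m<1+n j<i))))
          (trans e (sym (cong₂ ℚ._+_ (below-< (s≤s (ℕ.≤-trans (ℕ.<⇒≤ j<i) (ℕ.m≤m+n i k)))) q)))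

-- The entries of a row are a signed sum of four initial-segment indicators; the negative ones stand
-- on the left. Pairing with `v` turns each into a prefix sum.
A-below : ∀ k (i j : Fin n) →
  A n k i j ℚ.+ (below (toℕ i) (toℕ j) ℚ.+ below (suc (toℕ i)) (toℕ j)) ≡
  below (suc (toℕ i + k)) (toℕ j) ℚ.+ below (toℕ i ∸ k) (toℕ j)
A-below k i j with ℕ.<-cmp (toℕ i) (toℕ j)
... | tri< i<j _ _ = upper-below k i<j
... | tri≈ _ i≡j _ = diagonal-below k i≡j
... | tri> _ _ j<i = lower-below k j<i

-- The truncation in i ∸ k is harmless: prefix v 0 = 0 is also the value at negative indices.
A-prefix : ∀ k (v : Vector ℚ n) (i : Fin n) →
  (A n k · v) i ℚ.+ (prefix v (toℕ i) ℚ.+ prefix v (suc (toℕ i))) ≡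
  prefix v (suc (toℕ i + k)) ℚ.+ prefix v (toℕ i ∸ k)
A-prefix {n} k v i = begin
  (A n k · v) i ℚ.+ (prefix v (toℕ i) ℚ.+ prefix v (suc (toℕ i)))
    ≡⟨ cong ((A n k · v) i ℚ.+_) (sum-below₂ v (toℕ i) (suc (toℕ i))) ⟨
  (A n k · v) i ℚ.+ ∑[ j < n ] (h j ℚ.* v j)
    ≡⟨ ∑-distrib-+ (λ j → A n k i j ℚ.* v j) (λ j → h j ℚ.* v j) ⟨
  ∑[ j < n ] (A n k i j ℚ.* v j ℚ.+ h j ℚ.* v j)
    ≡⟨ sum-cong-≗ (λ j → trans (sym (ℚ.*-distribʳ-+ (v j) (A n k i j) (h j))) (cong (ℚ._* v j) (A-below k i j))) ⟩
  ∑[ j < n ] ((below (suc (toℕ i + k)) (toℕ j) ℚ.+ below (toℕ i ∸ k) (toℕ j)) ℚ.* v j)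
    ≡⟨ sum-below₂ v (suc (toℕ i + k)) (toℕ i ∸ k) ⟩
  prefix v (suc (toℕ i + k)) ℚ.+ prefix v (toℕ i ∸ k) ∎
  where
  open ≡-Reasoning
  h : Fin n → ℚ
  h j = below (toℕ i) (toℕ j) ℚ.+ below (suc (toℕ i)) (toℕ j)

-- The kernel as the solution space of a recurrence

-- 2k + 5, written so that the blocks of length k + 1 can be split off definitionally.
order : ℕ → ℕ
order k = suc k + (suc k + 3)

-- low is row j ≤ k and high is row k + 1 + t of the recurrence for prefix sums.
record Solution (k : ℕ) (s : ℕ → ℚ) : Set where
  field
    start : s 0 ≡ 0ℚ
    low   : ∀ {j} → j ≤ k → s (suc k + j) ≡ s j ℚ.+ s (suc j)
    high  : ∀ {t} → t ≤ 3 + k → s (suc k + (suc k + t)) ℚ.+ s (suc t) ≡ s (suc k + t) ℚ.+ s (suc k + suc t)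
    final : ∀ m → s (order k + m) ≡ s (order k)

open Solution

index-top : ∀ k t → suc k + (suc k + t) ≡ suc (suc k + t + k)
index-top k t = cong suc (ℕ.+-comm k (suc k + t))

index-bottom : ∀ k t → suc t ≡ suc k + t ∸ k
index-bottom k t = sym (trans (cong (_∸ k) (sym (ℕ.+-suc k t))) (ℕ.m+n∸m≡n k (suc t)))

kernel⇒solution : ∀ k {v} → Kernel (A (order k) k) v → Solution k (prefix v)
kernel⇒solution k {v} z = record
  { start = prefix-zero v
  ; low   = λ {j} j≤k → begin
      prefix v (suc k + j)
        ≡⟨ cong (prefix v ∘ suc) (ℕ.+-comm k j) ⟩
      prefix v (suc (j + k))
        ≡⟨ ℚ.+-identityʳ _ ⟨
      prefix v (suc (j + k)) ℚ.+ 0ℚ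
        ≡⟨ cong (prefix v (suc (j + k)) ℚ.+_) (trans (cong (prefix v) (ℕ.m≤n⇒m∸n≡0 j≤k)) (prefix-zero v)) ⟨
      prefix v (suc (j + k)) ℚ.+ prefix v (j ∸ k)
        ≡⟨ row j (s≤s (ℕ.≤-trans j≤k (ℕ.m≤m+n k _))) ⟩
      prefix v j ℚ.+ prefix v (suc j) ∎
  ; high  = λ {t} t≤3+k → begin
      prefix v (suc k + (suc k + t)) ℚ.+ prefix v (suc t)
        ≡⟨ cong₂ (λ l m → prefix v l ℚ.+ prefix v m) (index-top k t) (index-bottom k t) ⟩
      prefix v (suc (suc k + t + k)) ℚ.+ prefix v (suc k + t ∸ k)
        -- The bound `t ≤ 3 + k` says precisely that `suc k + t` is a row index below `order k`.
        ≡⟨ row (suc k + t) (ℕ.+-monoʳ-< (suc k) (s≤s (subst (t ≤_) (ℕ.+-comm 3 k) t≤3+k))) ⟩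
      prefix v (suc k + t) ℚ.+ prefix v (suc (suc k + t))
        ≡⟨ cong (λ m → prefix v (suc k + t) ℚ.+ prefix v m) (ℕ.+-suc (suc k) t) ⟨
      prefix v (suc k + t) ℚ.+ prefix v (suc k + suc t) ∎
  ; final = prefix-saturates v
  }
  where
  open ≡-Reasoning
  row : ∀ i → i < order k → prefix v (suc (i + k)) ℚ.+ prefix v (i ∸ k) ≡ prefix v i ℚ.+ prefix v (suc i)
  row i i<n = subst (λ i → prefix v (suc (i + k)) ℚ.+ prefix v (i ∸ k) ≡ prefix v i ℚ.+ prefix v (suc i))
    (toℕ-fromℕ< i<n)
    (trans (sym (A-prefix k v f))
      (trans (cong (ℚ._+ (prefix v (toℕ f) ℚ.+ prefix v (suc (toℕ f)))) (z f)) (ℚ.+-identityˡ _)))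
    where f = fromℕ< i<n

-- For `i ≤ k` the truncated index gives `s 0`, which is 0, and the row is `low`; the others are
-- `high` at `t = i ∸ suc k`.
solution⇒row : ∀ k {s} → Solution k s → ∀ i → i < order k →
  s (suc (i + k)) ℚ.+ s (i ∸ k) ≡ s i ℚ.+ s (suc i)
solution⇒row k {s} sol i i<n with i ℕ.≤? k
... | yes i≤k = begin
  s (suc (i + k)) ℚ.+ s (i ∸ k)
    ≡⟨ cong₂ ℚ._+_ (cong (s ∘ suc) (ℕ.+-comm i k)) (trans (cong s (ℕ.m≤n⇒m∸n≡0 i≤k)) (sol .start)) ⟩
  s (suc k + i) ℚ.+ 0ℚ
    ≡⟨ ℚ.+-identityʳ _ ⟩
  s (suc k + i)
    ≡⟨ sol .low i≤k ⟩
  s i ℚ.+ s (suc i) ∎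
  where open ≡-Reasoning
... | no  i≰k = subst (λ i → s (suc (i + k)) ℚ.+ s (i ∸ k) ≡ s i ℚ.+ s (suc i)) i≡ (begin
  s (suc (suc k + t + k)) ℚ.+ s (suc k + t ∸ k)
    ≡⟨ cong₂ (λ l m → s l ℚ.+ s m) (index-top k t) (index-bottom k t) ⟨
  s (suc k + (suc k + t)) ℚ.+ s (suc t)
    ≡⟨ sol .high t≤3+k ⟩
  s (suc k + t) ℚ.+ s (suc k + suc t)
    ≡⟨ cong (λ m → s (suc k + t) ℚ.+ s m) (ℕ.+-suc (suc k) t) ⟩
  s (suc k + t) ℚ.+ s (suc (suc k + t)) ∎)
  where
  open ≡-Reasoning
  t = i ∸ suc k
  i≡ : suc k + t ≡ i
  i≡ = ℕ.m+[n∸m]≡n (ℕ.≰⇒> i≰k)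
  t≤3+k : t ≤ 3 + k
  t≤3+k = subst (t ≤_) (ℕ.+-comm k 3)
    (s≤s⁻¹ (ℕ.+-cancelˡ-< (suc k) t (suc k + 3) (subst (_< order k) (sym i≡) i<n)))

-- Up to `order k` this is telescoping with `start`; beyond it both sides are constant, the right
-- one by `final`.
prefix-difference-solution : ∀ k {s} → Solution k s → ∀ m → prefix {order k} (difference s) m ≡ s m
prefix-difference-solution k {s} sol m = case m ℕ.≤? order k of λ where
    (yes m≤n) → inside m≤n
    (no  m≰n) → subst (λ m → prefix {order k} (difference s) m ≡ s m)
      (ℕ.m+[n∸m]≡n (ℕ.<⇒≤ (ℕ.≰⇒> m≰n)))
      (trans (prefix-saturates {order k} (difference s) _) (trans (inside ℕ.≤-refl) (sym (sol .final _))))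
  where
  inside : ∀ {m} → m ≤ order k → prefix {order k} (difference s) m ≡ s m
  inside {m} m≤n = trans (prefix-difference (order k) s m≤n)
    (trans (cong (λ x → s m ℚ.- x) (sol .start)) (ℚ.+-identityʳ (s m)))

solution⇒kernel : ∀ k {s} → Solution k s → Kernel (A (order k) k) (difference s)
solution⇒kernel k {s} sol i = +-cancelʳ _ _ 0ℚ (begin
  (A (order k) k · v) i ℚ.+ (prefix v (toℕ i) ℚ.+ prefix v (suc (toℕ i)))
    ≡⟨ A-prefix k v i ⟩
  prefix v (suc (toℕ i + k)) ℚ.+ prefix v (toℕ i ∸ k)
    ≡⟨ cong₂ ℚ._+_ (p (suc (toℕ i + k))) (p (toℕ i ∸ k)) ⟩
  s (suc (toℕ i + k)) ℚ.+ s (toℕ i ∸ k)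
    ≡⟨ solution⇒row k sol (toℕ i) (toℕ<n i) ⟩
  s (toℕ i) ℚ.+ s (suc (toℕ i))
    ≡⟨ cong₂ ℚ._+_ (p (toℕ i)) (p (suc (toℕ i))) ⟨
  prefix v (toℕ i) ℚ.+ prefix v (suc (toℕ i))
    ≡⟨ ℚ.+-identityˡ _ ⟨
  0ℚ ℚ.+ (prefix v (toℕ i) ℚ.+ prefix v (suc (toℕ i))) ∎)
  where
  open ≡-Reasoning
  v : Vector ℚ (order k)
  v = difference s
  p = prefix-difference-solution k sol

-- Passing to prefix sums and back by differences carries a line of solutions to a line in the
-- kernel. The value 1 at `m₀` lets the coefficient be read off, hence independence.
nullity-one : ∀ k s₀ → Solution k s₀ → ∀ m₀ → s₀ m₀ ≡ 1ℚ →
  (∀ s → Solution k s → ∃[ c ] (∀ m → s m ≡ c ℚ.* s₀ m)) → N[ order k , k ]≡ 1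
nullity-one k s₀ sol m₀ s₀m₀≡1 span =
  (λ _ → b) , (λ _ → solution⇒kernel k sol) , independent , spanning
  where
  open ≡-Reasoning
  b : Vector ℚ (order k)
  b = difference s₀
  independent : LinearlyIndependent {d = 1} (λ _ → b)
  independent c z zero = begin
    c zero
      ≡⟨ ℚ.*-identityʳ (c zero) ⟨
    c zero ℚ.* 1ℚ
      ≡⟨ cong (c zero ℚ.*_) (trans (prefix-difference-solution k sol m₀) s₀m₀≡1) ⟨
    c zero ℚ.* prefix b m₀
      ≡⟨ prefix-scale (c zero) b m₀ ⟨
    prefix (λ j → c zero ℚ.* b j) m₀
      -- For a single vector `linComb` unfolds to `c zero ℚ.* b j ℚ.+ 0ℚ`.
      ≡⟨ prefix-vanishes _ (λ j → trans (sym (ℚ.+-identityʳ _)) (z j)) m₀ ⟩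
    0ℚ ∎
  spanning : ∀ v → Kernel (A (order k) k) v → ∃[ c ] linComb {d = 1} c (λ _ → b) ≗ v
  spanning v z with span (prefix v) (kernel⇒solution k z)
  ... | c , e = (λ _ → c) , λ j → begin
    c ℚ.* b j ℚ.+ 0ℚ
      ≡⟨ solve 3 (λ c x y → c :* (x :- y) :+ con 0ℚ := c :* x :- c :* y) refl c _ _ ⟩
    c ℚ.* s₀ (suc (toℕ j)) ℚ.- c ℚ.* s₀ (toℕ j)
      ≡⟨ cong₂ ℚ._-_ (e (suc (toℕ j))) (e (toℕ j)) ⟨
    prefix v (suc (toℕ j)) ℚ.- prefix v (toℕ j)
      ≡⟨ cong (ℚ._- prefix v (toℕ j)) (prefix-suc v j) ⟩
    prefix v (toℕ j) ℚ.+ v j ℚ.- prefix v (toℕ j)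
      ≡⟨ solve 2 (λ x y → x :+ y :- x := y) refl (prefix v (toℕ j)) (v j) ⟩
    v j ∎

-- Sequences built from blocks and of period three

splice : ℕ → (ℕ → ℚ) → (ℕ → ℚ) → ℕ → ℚ
splice zero    f g m       = g m
splice (suc p) f g zero    = f 0
splice (suc p) f g (suc m) = splice p (f ∘ suc) g m

splice-< : ∀ {p} f g {m} → m < p → splice p f g m ≡ f m
splice-< {suc p} f g {zero}  _         = refl
splice-< {suc p} f g {suc m} (s≤s m<p) = splice-< (f ∘ suc) g m<p

splice-+ : ∀ p f g m → splice p f g (p + m) ≡ g m
splice-+ zero    f g m = refl
splice-+ (suc p) f g m = splice-+ p (f ∘ suc) g m

-- Identifies a sequence block by block; it serves both for arbitrary solutions and for scalar
-- multiples of the family.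
splice-unique : ∀ p {f g s : ℕ → ℚ} → (∀ {m} → m < p → s m ≡ f m) → (∀ m → s (p + m) ≡ g m) →
  ∀ m → s m ≡ splice p f g m
splice-unique zero    _  eg m       = eg m
splice-unique (suc p) ef eg zero    = ef (s≤s z≤n)
splice-unique (suc p) ef eg (suc m) = splice-unique p (ef ∘ s≤s) eg m

cycle : ℚ → ℚ → ℚ → ℕ → ℚ
cycle x y z zero    = x
cycle x y z (suc m) = cycle y z x m

cycle-sum : ∀ x y z m → cycle x y z m ℚ.+ cycle x y z (1 + m) ℚ.+ cycle x y z (2 + m) ≡ x ℚ.+ y ℚ.+ z
cycle-sum x y z zero    = refl
cycle-sum x y z (suc m) = trans (cycle-sum y z x m)
  (solve 3 (λ x y z → y :+ z :+ x := x :+ y :+ z) refl x y z)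

cycle-scale : ∀ c {x y z x′ y′ z′} → x′ ≡ c ℚ.* x → y′ ≡ c ℚ.* y → z′ ≡ c ℚ.* z →
  ∀ m → cycle x′ y′ z′ m ≡ c ℚ.* cycle x y z m
cycle-scale c ex ey ez zero    = ex
cycle-scale c ex ey ez (suc m) = cycle-scale c ey ez ex m

-- The two-parameter family of candidates

module Family (α γ : ℚ) where

  opening : ℕ → ℚ
  opening 0 = 0ℚ
  opening 1 = α
  opening 2 = 0ℚ
  opening (suc (suc (suc m))) = cycle γ 0ℚ α m

  -- The values dictated by `low`. At `j = k` this reads `opening` one place past its block, where
  -- `Closing` makes it agree with the family.
  middle : ℕ → ℚ
  middle j = opening j ℚ.+ opening (suc j)

  -- The first three values are those given by `high` at `t` = 0, 1, 2 when the entries at 2 and 4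
  -- vanish; from `order k` on the value is the total.
  ending : ℕ → ℚ
  ending 0 = α
  ending 1 = α ℚ.+ γ
  ending 2 = γ
  ending (suc (suc (suc _))) = α ℚ.+ γ

  family : ℕ → ℕ → ℚ
  family k = splice (suc k) opening (splice (suc k) middle ending)

  family-opening : ∀ k {j} → j ≤ k → family k j ≡ opening j
  family-opening k j≤k = splice-< opening _ (s≤s j≤k)

  family-middle : ∀ k {j} → j ≤ k → family k (suc k + j) ≡ middle j
  family-middle k j≤k = trans (splice-+ (suc k) opening _ _) (splice-< middle ending (s≤s j≤k))

  family-ending : ∀ k u → family k (suc k + (suc k + u)) ≡ ending u
  family-ending k u = trans (splice-+ (suc k) opening _ _) (splice-+ (suc k) middle ending u)

  opening-sum : ∀ m → opening (3 + m) ℚ.+ opening (4 + m) ℚ.+ opening (5 + m) ≡ α ℚ.+ γ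
  opening-sum m = trans (cycle-sum γ 0ℚ α m)
    (solve 2 (λ α γ → γ :+ con 0ℚ :+ α := α :+ γ) refl α γ)

open Family

-- With k = 3 + m: the conditions s k = γ and s (k + 1) = α.
Closing : ℕ → ℚ → ℚ → Set
Closing m α γ = cycle γ 0ℚ α m ≡ γ × cycle γ 0ℚ α (suc m) ≡ α

-- The case k ≥ 3

module _ (m : ℕ) where

  private
    k = 3 + m

  -- The `high` rows fall into three groups: `t` < 3 is checked directly, 3 ≤ `t` < `k` is
  -- `opening-sum`, and the last four are `last-rows`.
  family-solution : ∀ {α γ} → Closing m α γ → Solution k (family α γ k)
  family-solution {α} {γ} (ak≡γ , ak+1≡α) = record
    { start = refl
    ; low   = λ {j} j≤k → trans (family-middle α γ k j≤k)
        (sym (cong₂ ℚ._+_ (extended (ℕ.m≤n⇒m≤1+n j≤k)) (extended (s≤s j≤k))))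
    ; high  = high′ _
    ; final = λ u → trans (cong F (trans (ℕ.+-assoc (suc k) (suc k + 3) u) (cong (suc k +_) (ℕ.+-assoc (suc k) 3 u))))
        (trans (family-ending α γ k (3 + u)) (sym (family-ending α γ k 3)))
    }
    where
    F = family α γ k
    a = opening α γ

    F[1+k] : F (suc k + 0) ≡ α
    F[1+k] = trans (family-middle α γ k {0} z≤n) (ℚ.+-identityˡ α)

    -- Index `suc k` belongs to the second block, with value `α`; the second closing condition
    -- identifies it with `opening`.
    extended : ∀ {j} → j ≤ suc k → F j ≡ a j
    extended {j} j≤1+k with ℕ.m≤n⇒m<n∨m≡n j≤1+k
    ... | inj₁ (s≤s j≤k) = family-opening α γ k j≤k
    ... | inj₂ refl      = trans (cong F (sym (ℕ.+-identityʳ (suc k)))) (trans F[1+k] (sym ak+1≡α))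

    evaluate : ∀ {x y z w x′ y′ z′ w′ : ℚ} → x ≡ x′ → y ≡ y′ → z ≡ z′ → w ≡ w′ →
               x′ ℚ.+ y′ ≡ z′ ℚ.+ w′ → x ℚ.+ y ≡ z ℚ.+ w
    evaluate refl refl refl refl e = e

    Row : ℕ → Set
    Row t = F (suc k + (suc k + t)) ℚ.+ F (suc t) ≡ F (suc k + t) ℚ.+ F (suc k + suc t)

    1≤k : 1 ≤ k
    1≤k = s≤s z≤n
    2≤k : 2 ≤ k
    2≤k = s≤s (s≤s z≤n)
    3≤k : 3 ≤ k
    3≤k = ℕ.m≤m+n 3 m

    -- Among these four only `u = 0` uses the closing conditions; the others are identities in `α`
    -- and `γ`.
    last-rows : ∀ u → u ≤ 3 → Row (k + u)
    last-rows 0 _ = evaluate (family-ending α γ k (k + 0)) (trans (cong (F ∘ suc) (ℕ.+-identityʳ k)) (extended ℕ.≤-refl))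
      (trans (cong (λ j → F (suc k + j)) (ℕ.+-identityʳ k)) (family-middle α γ k ℕ.≤-refl)) (family-ending α γ k 0)
      (trans (cong ((α ℚ.+ γ) ℚ.+_) ak+1≡α)
        (trans (solve 2 (λ α γ → (α :+ γ) :+ α := (γ :+ α) :+ α) refl α γ)
          (sym (cong (ℚ._+ α) (cong₂ ℚ._+_ ak≡γ ak+1≡α)))))
    last-rows 1 _ = evaluate (family-ending α γ k (k + 1)) (family-middle α γ k 1≤k)
      (trans (cong (λ j → F (suc k + j)) (ℕ.+-suc k 0)) (family-ending α γ k 0)) (family-ending α γ k 1)
      (solve 2 (λ α γ → (α :+ γ) :+ (α :+ con 0ℚ) := α :+ (α :+ γ)) refl α γ)
    last-rows 2 _ = evaluate (family-ending α γ k (k + 2)) (family-middle α γ k 2≤k)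
      (trans (cong (λ j → F (suc k + j)) (ℕ.+-suc k 1)) (family-ending α γ k 1)) (family-ending α γ k 2)
      (solve 2 (λ α γ → (α :+ γ) :+ (con 0ℚ :+ γ) := (α :+ γ) :+ γ) refl α γ)
    last-rows 3 _ = evaluate (family-ending α γ k (k + 3)) (family-middle α γ k 3≤k)
      (trans (cong (λ j → F (suc k + j)) (ℕ.+-suc k 2)) (family-ending α γ k 2)) (family-ending α γ k 3)
      (solve 2 (λ α γ → (α :+ γ) :+ (γ :+ con 0ℚ) := γ :+ (α :+ γ)) refl α γ)
    last-rows (suc (suc (suc (suc _)))) (s≤s (s≤s (s≤s ())))

    high′ : ∀ t → t ≤ 3 + k → Row t
    high′ 0 _ = evaluate (family-ending α γ k 0) (extended (s≤s z≤n)) (family-middle α γ k {0} z≤n) (family-middle α γ k 1≤k)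
      (solve 1 (λ α → α :+ α := (con 0ℚ :+ α) :+ (α :+ con 0ℚ)) refl α)
    high′ 1 _ = evaluate (family-ending α γ k 1) (family-opening α γ k 2≤k) (family-middle α γ k 1≤k) (family-middle α γ k 2≤k)
      (solve 2 (λ α γ → (α :+ γ) :+ con 0ℚ := (α :+ con 0ℚ) :+ (con 0ℚ :+ γ)) refl α γ)
    high′ 2 _ = evaluate (family-ending α γ k 2) (family-opening α γ k 3≤k) (family-middle α γ k 2≤k) (family-middle α γ k 3≤k)
      (solve 1 (λ γ → γ :+ γ := (con 0ℚ :+ γ) :+ (γ :+ con 0ℚ)) refl γ)
    high′ t@(suc (suc (suc t′))) t≤3+k with t ℕ.<? k
    ... | yes t<k = evaluate (family-ending α γ k t) (family-opening α γ k t<k)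
      (family-middle α γ k (ℕ.<⇒≤ t<k)) (family-middle α γ k t<k)
      (trans (cong (ℚ._+ a (suc t)) (sym (opening-sum α γ t′)))
        (solve 3 (λ x y z → (x :+ y :+ z) :+ y := (x :+ y) :+ (y :+ z)) refl (a t) (a (suc t)) (a (2 + t))))
    ... | no  t≮k = subst Row (ℕ.m+[n∸m]≡n (ℕ.≮⇒≥ t≮k))
      (last-rows (t ∸ k) (ℕ.m≤n+o⇒m∸n≤o t k (subst (t ≤_) (ℕ.+-comm 3 k) t≤3+k)))

  -- Every solution lies in the family

  module _ {s : ℕ → ℚ} (sol : Solution k s) where

    private
      α γ T : ℚ
      α = s 1
      γ = s 3
      T = s (suc k + (suc k + 3))

      end : ℕ → ℚ
      end u = s (suc k + (suc k + u))

      end-T : ∀ u → end (3 + u) ≡ T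
      end-T u = trans (cong s (sym (trans (ℕ.+-assoc (suc k) (suc k + 3) u)
        (cong (suc k +_) (ℕ.+-assoc (suc k) 3 u))))) (sol .final u)

      mid : ∀ j → j ≤ 3 → s (suc k + j) ≡ s j ℚ.+ s (suc j)
      mid j j≤3 = sol .low (ℕ.≤-trans j≤3 (ℕ.m≤m+n 3 m))

      -- Row `t = k + u`: as `k ≥ 3`, its leading index is at least `order k`, so that term is `T`.
      last-row : ∀ {u} → u ≤ 3 → T ℚ.+ s (suc k + u) ≡ s (suc k + (k + u)) ℚ.+ end u
      last-row {u} u≤3 = trans (cong (ℚ._+ s (suc k + u)) (sym (end-T (m + u))))
        (sol .high (subst (k + u ≤_) (ℕ.+-comm k 3) (ℕ.+-monoʳ-≤ k u≤3)))

      last-row′ : ∀ {u} → suc u ≤ 3 → T ℚ.+ s (suc k + suc u) ≡ end u ℚ.+ end (suc u)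
      last-row′ {u} u≤3 = trans (last-row u≤3) (cong (λ j → s (suc k + j) ℚ.+ end (suc u)) (ℕ.+-suc k u))

      s[1+k] : s (suc k) ≡ α
      s[1+k] = trans (cong s (sym (ℕ.+-identityʳ (suc k))))
        (trans (mid 0 z≤n) (trans (cong (ℚ._+ α) (sol .start)) (ℚ.+-identityˡ α)))

      s[1+k+0] : s (suc k + 0) ≡ α
      s[1+k+0] = trans (cong s (ℕ.+-identityʳ (suc k))) s[1+k]

      end₀ : end 0 ≡ α ℚ.+ s 2
      end₀ = cancelling
        (trans (sol .high z≤n) (cong₂ ℚ._+_ s[1+k+0] (mid 1 (s≤s z≤n))))
        (solve 3 (λ e x y → e :+ (x :+ (x :+ y)) := (x :+ y) :+ (e :+ x)) refl (end 0) α (s 2))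

      end₁ : end 1 ≡ α ℚ.+ s 2 ℚ.+ γ
      end₁ = cancelling
        (trans (sol .high (s≤s z≤n)) (cong₂ ℚ._+_ (mid 1 (s≤s z≤n)) (mid 2 (s≤s (s≤s z≤n)))))
        (solve 4 (λ e x y z → e :+ ((x :+ y) :+ (y :+ z)) := (x :+ y :+ z) :+ (e :+ y)) refl (end 1) α (s 2) γ)

      end₂ : end 2 ≡ s 2 ℚ.+ γ ℚ.+ s 4
      end₂ = cancelling
        (trans (sol .high (s≤s (s≤s z≤n))) (cong₂ ℚ._+_ (mid 2 (s≤s (s≤s z≤n))) (mid 3 ℕ.≤-refl)))
        (solve 4 (λ e x y z → e :+ ((x :+ y) :+ (y :+ z)) := (x :+ y :+ z) :+ (e :+ y)) refl (end 2) (s 2) γ (s 4))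

      -- Row `t = k + 3` reads T + s 3 + s 4 = `end 2` + T, and `end₂` exceeds s 3 + s 4 by s 2.
      s₂≡0 : s 2 ≡ 0ℚ
      s₂≡0 = cancelling
        (sym (trans (cong (T ℚ.+_) (sym (mid 3 ℕ.≤-refl))) (trans (last-row′ ℕ.≤-refl) (cong (ℚ._+ T) end₂))))
        (solve 4 (λ t x y z → x :+ (t :+ (y :+ z)) := con 0ℚ :+ (x :+ y :+ z :+ t)) refl T (s 2) γ (s 4))

      -- Row `t = k + 1`, with `end₀` and `end₁` inserted.
      T≡ : T ≡ α ℚ.+ s 2 ℚ.+ γ
      T≡ = cancelling
        (trans (cong (T ℚ.+_) (sym (mid 1 (s≤s z≤n)))) (trans (last-row′ (s≤s z≤n)) (cong₂ ℚ._+_ end₀ end₁)))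
        (solve 4 (λ t x y z → t :+ ((x :+ y) :+ (x :+ y :+ z)) := (x :+ y :+ z) :+ (t :+ (x :+ y))) refl T α (s 2) γ)

      T≡α+γ : T ≡ α ℚ.+ γ
      T≡α+γ = trans T≡ (cong (ℚ._+ γ) (trans (cong (α ℚ.+_) s₂≡0) (ℚ.+-identityʳ α)))

      -- Row `t = k + 2`, with `T≡` eliminating the total.
      s₄≡0 : s 4 ≡ 0ℚ
      s₄≡0 = cancelling
        (cong₂ ℚ._+_
          (sym (trans (cong (T ℚ.+_) (sym (mid 2 (s≤s (s≤s z≤n)))))
            (trans (last-row′ (s≤s (s≤s z≤n))) (cong₂ ℚ._+_ end₁ end₂))))
          T≡)
        (solve 5 (λ t x y z w →
            w :+ ((t :+ (y :+ z)) :+ (x :+ y :+ z)) :=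
            con 0ℚ :+ (((x :+ y :+ z) :+ (y :+ z :+ w)) :+ t)) refl T α (s 2) γ (s 4))

      -- Row `t = k`, where `low` at `k` expands s (2k + 1) as s k + `α`.
      s[k] : s k ≡ γ
      s[k] = cancelling
        (cong₂ ℚ._+_
          (sym (trans (cong (T ℚ.+_) (sym s[1+k+0])) (trans (last-row z≤n) (cong₂ ℚ._+_
            (trans (cong (λ j → s (suc k + j)) (ℕ.+-identityʳ k))
              (trans (sol .low ℕ.≤-refl) (cong (s k ℚ.+_) s[1+k])))
            end₀))))
          T≡)
        (solve 5 (λ t x y z w →
            w :+ ((t :+ x) :+ (x :+ y :+ z)) :=
            z :+ (((w :+ x) :+ (x :+ y)) :+ t)) refl T α (s 2) γ (s k))

      -- Row `t = 3 + i` for `t < k`: the leading term is `T`, and expanding the right side by `low`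
      -- cancels one copy of s (4 + i).
      three-term : ∀ {i} → i < m → s (3 + i) ℚ.+ s (4 + i) ℚ.+ s (5 + i) ≡ α ℚ.+ γ
      three-term {i} i<m = trans (sym (cancelling
        (trans (cong (ℚ._+ s (4 + i)) (sym (end-T i)))
          (trans (sol .high (ℕ.≤-trans 3+i≤k (ℕ.m≤n+m k 3)))
            (cong₂ ℚ._+_ (sol .low 3+i≤k) (sol .low (ℕ.+-monoʳ-≤ 3 i<m)))))
        (solve 4 (λ t x y z → t :+ ((x :+ y) :+ (y :+ z)) := (x :+ y :+ z) :+ (t :+ y))
          refl T (s (3 + i)) (s (4 + i)) (s (5 + i))))) T≡α+γ
        where
        3+i≤k : 3 + i ≤ k
        3+i≤k = ℕ.+-monoʳ-≤ 3 (ℕ.<⇒≤ i<m)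

      -- Two consecutive values are carried along because `three-term` determines the next one, and
      -- `opening` obeys the same relation.
      periodic : ∀ i → i ≤ m → s (3 + i) ≡ opening α γ (3 + i) × s (4 + i) ≡ opening α γ (4 + i)
      periodic zero    _   = refl , s₄≡0
      periodic (suc i) i<m with periodic i (ℕ.<⇒≤ i<m)
      ... | p , q = q , cancelling
        (cong₂ ℚ._+_ (trans (cong₂ (λ x y → x ℚ.+ y ℚ.+ s (5 + i)) (sym p) (sym q)) (three-term i<m))
          (sym (opening-sum α γ i)))
        (solve 5 (λ x y z z′ t → z :+ (t :+ (x :+ y :+ z′)) := z′ :+ ((x :+ y :+ z) :+ t)) refl
          (opening α γ (3 + i)) (opening α γ (4 + i)) (s (5 + i)) (opening α γ (5 + i)) (α ℚ.+ γ))

      initial : ∀ {j} → j ≤ suc k → s j ≡ opening α γ j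
      initial {0} _ = sol .start
      initial {1} _ = refl
      initial {2} _ = s₂≡0
      initial {3} _ = refl
      initial {suc (suc (suc (suc i)))} (s≤s (s≤s (s≤s (s≤s i≤m)))) with periodic i i≤m
      ... | _ , q = q

      terminal : ∀ u → end u ≡ ending α γ u
      terminal 0 = trans end₀ (trans (cong (α ℚ.+_) s₂≡0) (ℚ.+-identityʳ α))
      terminal 1 = trans end₁ (trans (sym T≡) T≡α+γ)
      terminal 2 = trans end₂ (trans (cong₂ (λ x y → x ℚ.+ γ ℚ.+ y) s₂≡0 s₄≡0)
        (trans (ℚ.+-identityʳ (0ℚ ℚ.+ γ)) (ℚ.+-identityˡ γ)))
      terminal (suc (suc (suc u))) = trans (end-T u) T≡α+γ

    -- At `i = m` the periodic pattern reaches the indices `k` and `k + 1`, whose values `s[k]` and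
    -- `s[1+k]` give independently.
    solution-closing : Closing m (s 1) (s 3)
    solution-closing with periodic m ℕ.≤-refl
    ... | p , q = trans (sym p) s[k] , trans (sym q) s[1+k]

    solution-family : ∀ j → s j ≡ family (s 1) (s 3) k j
    solution-family = splice-unique (suc k) (λ { (s≤s j≤k) → initial (ℕ.m≤n⇒m≤1+n j≤k) })
      (splice-unique (suc k)
        (λ { (s≤s j≤k) → trans (sol .low j≤k) (cong₂ ℚ._+_ (initial (ℕ.m≤n⇒m≤1+n j≤k)) (initial (s≤s j≤k))) })
        terminal)

-- Scaling, and the line cut out by the closing conditions

opening-scale : ∀ c α γ j → c ℚ.* opening α γ j ≡ opening (c ℚ.* α) (c ℚ.* γ) j
opening-scale c α γ 0 = ℚ.*-zeroʳ c
opening-scale c α γ 1 = refl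
opening-scale c α γ 2 = ℚ.*-zeroʳ c
opening-scale c α γ (suc (suc (suc m))) = sym (cycle-scale c refl (sym (ℚ.*-zeroʳ c)) refl m)

ending-scale : ∀ c α γ u → c ℚ.* ending α γ u ≡ ending (c ℚ.* α) (c ℚ.* γ) u
ending-scale c α γ 0 = refl
ending-scale c α γ 1 = ℚ.*-distribˡ-+ c α γ
ending-scale c α γ 2 = refl
ending-scale c α γ (suc (suc (suc _))) = ℚ.*-distribˡ-+ c α γ

family-scale : ∀ c α γ k j → c ℚ.* family α γ k j ≡ family (c ℚ.* α) (c ℚ.* γ) k j
family-scale c α γ k = splice-unique (suc k)
  (λ { {j} (s≤s j≤k) → trans (cong (c ℚ.*_) (family-opening α γ k j≤k)) (opening-scale c α γ j) })
  (splice-unique (suc k)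
    (λ { {j} (s≤s j≤k) → trans (cong (c ℚ.*_) (family-middle α γ k j≤k))
      (trans (ℚ.*-distribˡ-+ c _ _) (cong₂ ℚ._+_ (opening-scale c α γ j) (opening-scale c α γ (suc j)))) })
    (λ u → trans (cong (c ℚ.*_) (family-ending α γ k u)) (ending-scale c α γ u)))

-- The two closing conditions say α = 0, γ = 0 or α = γ according to the residue of m modulo 3.
closing-line : ∀ m → ∃[ α₀ ] ∃[ γ₀ ] Closing m α₀ γ₀ × (α₀ ≡ 1ℚ ⊎ γ₀ ≡ 1ℚ) ×
  (∀ α γ → Closing m α γ → ∃[ c ] (α ≡ c ℚ.* α₀ × γ ≡ c ℚ.* γ₀))
closing-line 0 = 0ℚ , 1ℚ , (refl , refl) , inj₂ refl ,
  λ { α γ (_ , 0≡α) → γ , trans (sym 0≡α) (sym (ℚ.*-zeroʳ γ)) , sym (ℚ.*-identityʳ γ) }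
closing-line 1 = 1ℚ , 0ℚ , (refl , refl) , inj₁ refl ,
  λ { α γ (0≡γ , _) → α , sym (ℚ.*-identityʳ α) , trans (sym 0≡γ) (sym (ℚ.*-zeroʳ α)) }
closing-line 2 = 1ℚ , 1ℚ , (refl , refl) , inj₁ refl ,
  λ { α γ (α≡γ , _) → α , sym (ℚ.*-identityʳ α) , trans (sym α≡γ) (sym (ℚ.*-identityʳ α)) }
-- Three rotations restore the arguments of `cycle`, so both closing conditions are unchanged by
-- computation.
closing-line (suc (suc (suc m))) = closing-line m

nullity-large : ∀ m → N[ order (3 + m) , 3 + m ]≡ 1
nullity-large m =
  let α₀ , γ₀ , closing , pivot , line = closing-line m
      m₀ , F[m₀]≡1 = pivot-index α₀ γ₀ pivot
  in nullity-one (3 + m) (family α₀ γ₀ (3 + m)) (family-solution m closing) m₀ F[m₀]≡1 (span α₀ γ₀ line)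
  where
  -- Both parameters occur as values of the family, at indices 1 and 3.
  pivot-index : ∀ α₀ γ₀ → α₀ ≡ 1ℚ ⊎ γ₀ ≡ 1ℚ → ∃[ m₀ ] family α₀ γ₀ (3 + m) m₀ ≡ 1ℚ
  pivot-index _ _ (inj₁ α₀≡1) = 1 , α₀≡1
  pivot-index _ _ (inj₂ γ₀≡1) = 3 , γ₀≡1
  span : ∀ α₀ γ₀ → (∀ α γ → Closing m α γ → ∃[ c ] (α ≡ c ℚ.* α₀ × γ ≡ c ℚ.* γ₀)) →
    ∀ s → Solution (3 + m) s → ∃[ c ] (∀ j → s j ≡ c ℚ.* family α₀ γ₀ (3 + m) j)
  span α₀ γ₀ line s sol =
    let c , α≡ , γ≡ = line (s 1) (s 3) (solution-closing m sol)
    in c , λ j → trans (solution-family m sol j)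
      (trans (cong₂ (λ α γ → family α γ (3 + m) j) α≡ γ≡) (sym (family-scale c α₀ γ₀ (3 + m) j)))

-- The cases k = 1 and k = 2

2ℚ 3ℚ 4ℚ : ℚ
2ℚ = 1ℚ ℚ.+ 1ℚ
3ℚ = 2ℚ ℚ.+ 1ℚ
4ℚ = 3ℚ ℚ.+ 1ℚ

-- Taken in order, the rows express each value from s 2 to s 7 through earlier ones; `s₀` is the
-- outcome for s 1 = 1.
nullity-k=1 : N[ order 1 , 1 ]≡ 1
nullity-k=1 = nullity-one 1 s₀ solution 1 refl λ s sol → s 1 , span s sol
  where
  s₀ : ℕ → ℚ
  s₀ 0 = 0ℚ
  s₀ 1 = 1ℚ
  s₀ 2 = 1ℚ
  s₀ 3 = 2ℚ
  s₀ 4 = 2ℚ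
  s₀ 5 = 3ℚ
  s₀ 6 = 3ℚ
  s₀ _ = 4ℚ
  solution : Solution 1 s₀
  solution = record { start = refl ; low = low′ _ ; high = high′ _ ; final = λ _ → refl }
    where
    low′ : ∀ j → j ≤ 1 → s₀ (2 + j) ≡ s₀ j ℚ.+ s₀ (suc j)
    low′ 0 _ = refl
    low′ 1 _ = refl
    low′ (suc (suc _)) (s≤s ())
    high′ : ∀ t → t ≤ 4 → s₀ (4 + t) ℚ.+ s₀ (suc t) ≡ s₀ (2 + t) ℚ.+ s₀ (3 + t)
    high′ 0 _ = refl
    high′ 1 _ = refl
    high′ 2 _ = refl
    high′ 3 _ = refl
    high′ 4 _ = refl
    high′ (suc (suc (suc (suc (suc _))))) (s≤s (s≤s (s≤s (s≤s ()))))
  module _ (s : ℕ → ℚ) (sol : Solution 1 s) where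
    c = s 1
    e₀ : s 0 ≡ c ℚ.* 0ℚ
    e₀ = trans (sol .start) (sym (ℚ.*-zeroʳ c))
    e₁ : s 1 ≡ c ℚ.* 1ℚ
    e₁ = sym (ℚ.*-identityʳ c)
    e₂ : s 2 ≡ c ℚ.* 1ℚ
    e₂ = low-step c (sol .low z≤n) e₀ e₁
    e₃ : s 3 ≡ c ℚ.* 2ℚ
    e₃ = low-step c (sol .low ℕ.≤-refl) e₁ e₂
    e₄ : s 4 ≡ c ℚ.* 2ℚ
    e₄ = step c (sol .high z≤n) e₁ e₂ e₃ refl
    e₅ : s 5 ≡ c ℚ.* 3ℚ
    e₅ = step c (sol .high (s≤s z≤n)) e₂ e₃ e₄ refl
    e₆ : s 6 ≡ c ℚ.* 3ℚ
    e₆ = step c (sol .high (s≤s (s≤s z≤n))) e₃ e₄ e₅ refl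
    e₇ : s 7 ≡ c ℚ.* 4ℚ
    e₇ = step c (sol .high (s≤s (s≤s (s≤s z≤n)))) e₄ e₅ e₆ refl
    span : ∀ m → s m ≡ c ℚ.* s₀ m
    span 0 = e₀
    span 1 = e₁
    span 2 = e₂
    span 3 = e₃
    span 4 = e₄
    span 5 = e₅
    span 6 = e₆
    span (suc (suc (suc (suc (suc (suc (suc m))))))) = trans (sol .final m) e₇

-- The rows in order express everything by s 1 and s 2. Once `s₂≡0` is known, s 1 alone remains, and
-- `s₀` is the outcome for s 1 = 1.
nullity-k=2 : N[ order 2 , 2 ]≡ 1
nullity-k=2 = nullity-one 2 s₀ solution 1 refl λ s sol → s 1 , span s sol
  where
  s₀ : ℕ → ℚ
  s₀ 0 = 0ℚ
  s₀ 1 = 1ℚ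
  s₀ 2 = 0ℚ
  s₀ 3 = 1ℚ
  s₀ 4 = 1ℚ
  s₀ 5 = 1ℚ
  s₀ 6 = 1ℚ
  s₀ 7 = 2ℚ
  s₀ 8 = 1ℚ
  s₀ _ = 2ℚ
  solution : Solution 2 s₀
  solution = record { start = refl ; low = low′ _ ; high = high′ _ ; final = λ _ → refl }
    where
    low′ : ∀ j → j ≤ 2 → s₀ (3 + j) ≡ s₀ j ℚ.+ s₀ (suc j)
    low′ 0 _ = refl
    low′ 1 _ = refl
    low′ 2 _ = refl
    low′ (suc (suc (suc _))) (s≤s (s≤s ()))
    high′ : ∀ t → t ≤ 5 → s₀ (6 + t) ℚ.+ s₀ (suc t) ≡ s₀ (3 + t) ℚ.+ s₀ (4 + t)
    high′ 0 _ = refl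
    high′ 1 _ = refl
    high′ 2 _ = refl
    high′ 3 _ = refl
    high′ 4 _ = refl
    high′ 5 _ = refl
    high′ (suc (suc (suc (suc (suc (suc _)))))) (s≤s (s≤s (s≤s (s≤s (s≤s ())))))
  module _ (s : ℕ → ℚ) (sol : Solution 2 s) where
    c = s 1
    -- Rows 8 and 5 give s 6 = s 8 and s 8 + s 3 = s 5 + s 6, hence s 3 = s 5 = s 2 + s 3.
    s₂≡0 : s 2 ≡ 0ℚ
    s₂≡0 = cancelling
      (cong₂ ℚ._+_ (cong₂ ℚ._+_
        (sym (sol .high {2} (s≤s (s≤s z≤n))))
        (sym (trans (cong (ℚ._+ s 6) (sym (sol .final 2))) (sol .high {5} ℕ.≤-refl))))
        (sym (sol .low ℕ.≤-refl)))
      (solve 6 (λ s₂ s₃ s₅ s₆ s₈ s₉ →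
          s₂ :+ (((s₈ :+ s₃) :+ (s₉ :+ s₆)) :+ s₅) :=
          con 0ℚ :+ (((s₅ :+ s₆) :+ (s₈ :+ s₉)) :+ (s₂ :+ s₃)))
        refl (s 2) (s 3) (s 5) (s 6) (s 8) (s 9))
    e₀ : s 0 ≡ c ℚ.* 0ℚ
    e₀ = trans (sol .start) (sym (ℚ.*-zeroʳ c))
    e₁ : s 1 ≡ c ℚ.* 1ℚ
    e₁ = sym (ℚ.*-identityʳ c)
    e₂ : s 2 ≡ c ℚ.* 0ℚ
    e₂ = trans s₂≡0 (sym (ℚ.*-zeroʳ c))
    e₃ : s 3 ≡ c ℚ.* 1ℚ
    e₃ = low-step c (sol .low z≤n) e₀ e₁
    e₄ : s 4 ≡ c ℚ.* 1ℚ
    e₄ = low-step c (sol .low (s≤s z≤n)) e₁ e₂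
    e₅ : s 5 ≡ c ℚ.* 1ℚ
    e₅ = low-step c (sol .low ℕ.≤-refl) e₂ e₃
    e₆ : s 6 ≡ c ℚ.* 1ℚ
    e₆ = step c (sol .high z≤n) e₁ e₃ e₄ refl
    e₇ : s 7 ≡ c ℚ.* 2ℚ
    e₇ = step c (sol .high (s≤s z≤n)) e₂ e₄ e₅ refl
    e₈ : s 8 ≡ c ℚ.* 1ℚ
    e₈ = step c (sol .high (s≤s (s≤s z≤n))) e₃ e₅ e₆ refl
    e₉ : s 9 ≡ c ℚ.* 2ℚ
    e₉ = step c (sol .high (s≤s (s≤s (s≤s z≤n)))) e₄ e₆ e₇ refl
    span : ∀ m → s m ≡ c ℚ.* s₀ m
    span 0 = e₀
    span 1 = e₁
    span 2 = e₂
    span 3 = e₃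
    span 4 = e₄
    span 5 = e₅
    span 6 = e₆
    span 7 = e₇
    span 8 = e₈
    span (suc (suc (suc (suc (suc (suc (suc (suc (suc m))))))))) = trans (sol .final m) e₉

-- Assembling the cases

order≡2k+5 : ∀ k → suc k + (suc k + 3) ≡ 2 * k + 5
order≡2k+5 = solve-∀

theorem8p5 : (k : ℕ) → k ≥ 1 → N[ 2 * k + 5 , k ]≡ 1
theorem8p5 k k≥1 = subst (λ n → N[ n , k ]≡ 1) (order≡2k+5 k) (nullity k k≥1)
  where
  nullity : ∀ k → k ≥ 1 → N[ order k , k ]≡ 1
  nullity 1 _ = nullity-k=1
  nullity 2 _ = nullity-k=2
  nullity (suc (suc (suc m))) _ = nullity-large m
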